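{- Let $n\ge 0$, let $\vec{u},\vec{v}$ be vertices of $W_n$, and let $\gamma,\gamma'$ be (combinatorial) paths in $W_n$ from $\vec{u}$ to $\vec{v}$. Then $\gamma\simeq\gamma'$.
   Context: For $n\ge 0$, $A_n=\{(x_1,\dots,x_{n+1})\in\mathbb{Z}^{n+1}:\sum_i x_i=0\}$, with metric $d(\vec{x},\vec{y})=\|\vec{x}-\vec{y}\|_1/2$. $W_n$ is the simplicial complex whose vertex set is $A_n$ and whose faces are the nonempty finite sets $F\subseteq A_n$ with $d(\vec{x},\vec{y})=1$ for all distinct $\vec{x},\vec{y}\in F$. In a simplicial complex $X$, a path from $v_0$ to $v_m$ is a finite sequence of vertices $v_0,\dots,v_m$ ($m\ge0$) with $v_i,v_{i+1}$ adjacent (forming an edge) for each $i$. If $\gamma=v_0,\dots,v_m$ ends at $v$ and $\delta=w_0,\dots,w_r$ starts at $v$, then $\gamma\cdot\delta$ is the path $v_0,\dots,v_m,w_1,\dots,w_r$. The relation $\simeq$ on paths is the smallest relation such that: (1) if $u,v$ are adjacent then $u,v,u\simeq u$; (2) if $\{u,v,w\}$ is a face of $X$ then $u,v,w\simeq u,w$; (3) if $\gamma\simeq\gamma'$ and $\delta\simeq\delta'$ (with $\gamma\cdot\delta$, $\gamma'\cdot\delta'$ defined) then $\gamma\cdot\delta\simeq\gamma'\cdot\delta'$; (4) $\gamma\simeq\gamma$; (5) $\gamma\simeq\gamma'$ implies $\gamma'\simeq\gamma$; (6) $\gamma\simeq\gamma'$ and $\gamma'\simeq\gamma''$ imply $\gamma\simeq\gamma''$.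 -}

module Defs where

open import Data.Nat using (ℕ; suc)
open import Data.Integer using (ℤ; _-_; ∣_∣) renaming (_+_ to _+ℤ_)
open import Data.Vec using (Vec; foldr; zipWith)
open import Data.Product using (Σ; _×_; _,_; proj₁)
open import Relation.Binary.PropositionalEquality using (_≡_)
import Data.Integer as ℤ
import Data.Nat as ℕ

-- Sum of the entries of an integer vector.
sumℤ : ∀ {m} → Vec ℤ m → ℤ
sumℤ = foldr _ _+ℤ_ (ℤ.+ 0)

-- The lattice A_n : integer vectors of length n+1 with coordinate sum 0.
A : ℕ → Set
A n = Σ (Vec ℤ (suc n)) (λ x → sumℤ x ≡ ℤ.+ 0)

-- ℓ¹ distance ‖x - y‖₁ (a natural number).
l1 : ∀ {m} → Vec ℤ m → Vec ℤ m → ℕ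
l1 x y = foldr _ ℕ._+_ 0 (zipWith (λ a b → ∣ a - b ∣) x y)

-- d(x,y) = ‖x-y‖₁/2 = 1, i.e. ‖x-y‖₁ = 2 : adjacency in W_n.
record Adj {n : ℕ} (x y : A n) : Set where
  constructor adj
  field dist≡2 : l1 (proj₁ x) (proj₁ y) ≡ 2

-- Combinatorial paths in W_n from u to v (indexed by endpoints).
data Path {n : ℕ} : A n → A n → Set where
  [_]  : (u : A n) → Path u u
  _∷_  : {u w v : A n} → Adj u w → Path w v → Path u v

-- Concatenation γ · δ.
_·_ : ∀ {n} {u v w : A n} → Path u v → Path v w → Path u w
[ _ ] · δ = δ
(a ∷ γ) · δ = a ∷ (γ · δ)

infixr 5 _∷_
infixr 4 _·_

-- Homotopy ≃ : smallest relation closed under (1)–(6).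
-- Paths with different endpoints can never be related by the generators
-- (each rule preserves endpoints), so the relation is indexed by endpoints.
-- Rule (2): {u,v,w} a face of W_n (with u,v,w,  u,w paths) means u,v,w
-- pairwise at distance 1.
data _≃_ {n : ℕ} : {u v : A n} → Path u v → Path u v → Set where
  backtrack : {u v : A n} (a : Adj u v) (b : Adj v u) →
              (a ∷ b ∷ [ u ]) ≃ [ u ]
  triangle  : {u v w : A n} (a : Adj u v) (b : Adj v w) (c : Adj u w) →
              (a ∷ b ∷ [ w ]) ≃ (c ∷ [ w ])
  concat    : {u v w : A n} {γ γ' : Path u v} {δ δ' : Path v w} →
              γ ≃ γ' → δ ≃ δ' → (γ · δ) ≃ (γ' · δ')
  ≃-refl    : {u v : A n} {γ : Path u v} → γ ≃ γ
  ≃-sym     : {u v : A n} {γ γ' : Path u v} → γ ≃ γ' → γ' ≃ γ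
  ≃-trans   : {u v : A n} {γ γ' γ'' : Path u v} →
              γ ≃ γ' → γ' ≃ γ'' → γ ≃ γ''

infix 3 _≃_

-- Every edge of W_n adds e_i - e_j to a vertex. An edge with i, j ≠ 0 is the third
-- side of the triangle through x + e_i - e_0, so every path is homotopic to one made
-- of "shifts" ±(e_{k+1} - e_0). Two shifts in different directions k ≠ l span a square
-- that is filled by two triangles (through its cross edge when the signs agree, through
-- its diagonal when they differ), and a shift followed by its inverse is a backtrack.
-- When the first shift of a loop is pushed forward along the loop, it either meets its
-- inverse (giving a homotopic shorter loop) or coordinate k+1 moves monotonically along
-- the whole loop, which is impossible since that coordinate returns to its initial value.
-- Hence loops are null-homotopic, and so any two paths with the same ends are homotopic.

module Submission where

open import Defs
open import Data.Nat using (ℕ; suc; _≤_; s≤s)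
import Data.Nat as ℕ
import Data.Nat.Properties as ℕₚ
open import Data.Integer using (ℤ; +_; -[1+_]; -_; _-_; ∣_∣; _◃_) renaming (_+_ to _+ℤ_)
import Data.Integer as ℤ
import Data.Integer.Properties as ℤₚ
open import Data.Integer.Tactic.RingSolver using (solve-∀)
open import Algebra.Properties.AbelianGroup ℤₚ.+-0-abelianGroup
  using (∙-cancelˡ; ∙-cancelʳ; identityˡ-unique)
open import Data.Fin using (Fin; zero; suc)
import Data.Fin.Properties as Finₚ
open import Data.Vec using (Vec; []; _∷_; lookup; updateAt)
open import Data.Vec.Properties
  using (updateAt-updateAt-local; updateAt-id; lookup∘updateAt; lookup∘updateAt′)
open import Data.Sign.Base as Sign using (Sign; opposite)
open import Function using (_∘_; id)
open import Data.Product using (Σ; _×_; _,_; proj₁; proj₂)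
open import Data.Sum using (_⊎_; inj₁; inj₂)
open import Data.Empty using (⊥-elim)
open import Relation.Nullary using (¬_; yes; no)
open import Relation.Binary.PropositionalEquality
open import Axiom.UniquenessOfIdentityProofs using (module Decidable⇒UIP)

stepℤ : Sign → ℤ → ℤ
stepℤ s a = (s ◃ 1) +ℤ a

stepℤ-comm : ∀ s t a → stepℤ s (stepℤ t a) ≡ stepℤ t (stepℤ s a)
stepℤ-comm s t = lemma (s ◃ 1) (t ◃ 1)
  where
  lemma : ∀ c d a → c +ℤ (d +ℤ a) ≡ d +ℤ (c +ℤ a)
  lemma = solve-∀

stepℤ-opposite : ∀ s a → stepℤ (opposite s) (stepℤ s a) ≡ a
stepℤ-opposite Sign.+ = ℤₚ.pred-suc
stepℤ-opposite Sign.- = ℤₚ.suc-pred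

_≤[_]_ : ℤ → Sign → ℤ → Set
a ≤[ Sign.+ ] b = a ℤ.≤ b
a ≤[ Sign.- ] b = b ℤ.≤ a

≤[]-refl : ∀ s a → a ≤[ s ] a
≤[]-refl Sign.+ a = ℤₚ.≤-refl
≤[]-refl Sign.- a = ℤₚ.≤-refl

≤[]-trans : ∀ s {a b c} → a ≤[ s ] b → b ≤[ s ] c → a ≤[ s ] c
≤[]-trans Sign.+ p q = ℤₚ.≤-trans p q
≤[]-trans Sign.- p q = ℤₚ.≤-trans q p

i≤[s]stepℤ[i] : ∀ s a → a ≤[ s ] stepℤ s a
i≤[s]stepℤ[i] Sign.+ a = ℤₚ.i≤suc[i] a
i≤[s]stepℤ[i] Sign.- a = ℤₚ.i≤j⇒pred[i]≤j ℤₚ.≤-refl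

stepℤ[i]≰[s]i : ∀ s a → ¬ stepℤ s a ≤[ s ] a
stepℤ[i]≰[s]i Sign.+ a p = ℤₚ.<-irrefl refl (ℤₚ.suc[i]≤j⇒i<j p)
stepℤ[i]≰[s]i Sign.- a p = ℤₚ.<-irrefl refl (ℤₚ.i≤pred[j]⇒i<j p)

∣i-stepℤ[i]∣≡1 : ∀ s a → ∣ a - stepℤ s a ∣ ≡ 1
∣i-stepℤ[i]∣≡1 s a = trans (cong ∣_∣ (lemma (s ◃ 1) a)) (∣-s◃1∣≡1 s)
  where
  lemma : ∀ c a → a - (c +ℤ a) ≡ - c
  lemma = solve-∀
  ∣-s◃1∣≡1 : ∀ s → ∣ - (s ◃ 1) ∣ ≡ 1
  ∣-s◃1∣≡1 Sign.+ = refl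
  ∣-s◃1∣≡1 Sign.- = refl

∣i-i∣≡0 : ∀ a → ∣ a - a ∣ ≡ 0
∣i-i∣≡0 a = cong ∣_∣ (ℤₚ.+-inverseʳ a)

i-j≡c⇒j≡-c+i : ∀ a b {c} → a - b ≡ c → b ≡ (- c) +ℤ a
i-j≡c⇒j≡-c+i a b refl = lemma a b
  where
  lemma : ∀ a b → b ≡ - (a - b) +ℤ a
  lemma = solve-∀

j+k≡i+k⇒i-j≡0 : ∀ i j k → j +ℤ k ≡ i +ℤ k → i - j ≡ + 0
j+k≡i+k⇒i-j≡0 i j k p = trans (cong (λ c → i - c) (∙-cancelʳ k j i p)) (ℤₚ.+-inverseʳ i)

updateAt-comm : ∀ {A : Set} {m} {f g : A → A} → (∀ a → f (g a) ≡ g (f a)) →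
                (x : Vec A m) (i j : Fin m) →
                updateAt (updateAt x i g) j f ≡ updateAt (updateAt x j f) i g
updateAt-comm fg≡gf (a ∷ x) zero    zero    = cong (_∷ x) (fg≡gf a)
updateAt-comm fg≡gf (a ∷ x) zero    (suc j) = refl
updateAt-comm fg≡gf (a ∷ x) (suc i) zero    = refl
updateAt-comm fg≡gf (a ∷ x) (suc i) (suc j) = cong (a ∷_) (updateAt-comm fg≡gf x i j)

sumℤ-updateAt-+ : ∀ {m} c (x : Vec ℤ m) i → sumℤ (updateAt x i (c +ℤ_)) ≡ c +ℤ sumℤ x
sumℤ-updateAt-+ c (a ∷ x) zero    = ℤₚ.+-assoc c a (sumℤ x)
sumℤ-updateAt-+ c (a ∷ x) (suc i) =
  trans (cong (a +ℤ_) (sumℤ-updateAt-+ c x i)) (lemma a c (sumℤ x))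
  where
  lemma : ∀ a c s → a +ℤ (c +ℤ s) ≡ c +ℤ (a +ℤ s)
  lemma = solve-∀

unit-steps-change-sumℤ : ∀ {m} s a (x : Vec ℤ m) i →
                         stepℤ s a +ℤ sumℤ (updateAt x i (stepℤ s)) ≢ a +ℤ sumℤ x
unit-steps-change-sumℤ s a x i p = 2s≢0 s (identityˡ-unique (c +ℤ c) (a +ℤ sumℤ x) (begin
  (c +ℤ c) +ℤ (a +ℤ sumℤ x)                  ≡⟨ regroup c a (sumℤ x) ⟩
  (c +ℤ a) +ℤ (c +ℤ sumℤ x)                  ≡⟨ cong (stepℤ s a +ℤ_) (sumℤ-updateAt-+ c x i) ⟨
  stepℤ s a +ℤ sumℤ (updateAt x i (stepℤ s)) ≡⟨ p ⟩
  a +ℤ sumℤ x                                ∎))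
  where
  open ≡-Reasoning
  c : ℤ
  c = s ◃ 1
  regroup : ∀ c a s → (c +ℤ c) +ℤ (a +ℤ s) ≡ (c +ℤ a) +ℤ (c +ℤ s)
  regroup = solve-∀
  2s≢0 : ∀ s → (s ◃ 1) +ℤ (s ◃ 1) ≢ + 0
  2s≢0 Sign.+ ()
  2s≢0 Sign.- ()

move : ∀ {m} → Fin m → Fin m → Vec ℤ m → Vec ℤ m
move i j x = updateAt (updateAt x i ℤ.suc) j ℤ.pred

sumℤ-move : ∀ {m} (x : Vec ℤ m) i j → sumℤ (move i j x) ≡ sumℤ x
sumℤ-move x i j = begin
  sumℤ (move i j x)                  ≡⟨ sumℤ-updateAt-+ -[1+ 0 ] (updateAt x i ℤ.suc) j ⟩
  ℤ.pred (sumℤ (updateAt x i ℤ.suc)) ≡⟨ cong ℤ.pred (sumℤ-updateAt-+ (+ 1) x i) ⟩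
  ℤ.pred (ℤ.suc (sumℤ x))            ≡⟨ ℤₚ.pred-suc (sumℤ x) ⟩
  sumℤ x                             ∎
  where open ≡-Reasoning

l1-sym : ∀ {m} (x y : Vec ℤ m) → l1 x y ≡ l1 y x
l1-sym []      []      = refl
l1-sym (a ∷ x) (b ∷ y) = cong₂ ℕ._+_ (ℤₚ.∣i-j∣≡∣j-i∣ a b) (l1-sym x y)

l1-refl : ∀ {m} (x : Vec ℤ m) → l1 x x ≡ 0
l1-refl []      = refl
l1-refl (a ∷ x) = cong₂ ℕ._+_ (∣i-i∣≡0 a) (l1-refl x)

l1-updateAt : ∀ {m} (x : Vec ℤ m) i f →
              l1 x (updateAt x i f) ≡ ∣ lookup x i - f (lookup x i) ∣
l1-updateAt (a ∷ x) zero    f = trans (cong (∣ a - f a ∣ ℕ.+_) (l1-refl x)) (ℕₚ.+-identityʳ _)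
l1-updateAt (a ∷ x) (suc i) f = cong₂ ℕ._+_ (∣i-i∣≡0 a) (l1-updateAt x i f)

l1-unit-step : ∀ {m} (x : Vec ℤ m) i s → l1 x (updateAt x i (stepℤ s)) ≡ 1
l1-unit-step x i s = trans (l1-updateAt x i (stepℤ s)) (∣i-stepℤ[i]∣≡1 s (lookup x i))

l1-move : ∀ {m} (x : Vec ℤ m) {i j} → i ≢ j → l1 x (move i j x) ≡ 2
l1-move (a ∷ x) {zero}  {zero}  i≢j = ⊥-elim (i≢j refl)
l1-move (a ∷ x) {zero}  {suc j} _   =
  cong₂ ℕ._+_ (∣i-stepℤ[i]∣≡1 Sign.+ a) (l1-unit-step x j Sign.-)
l1-move (a ∷ x) {suc i} {zero}  _   =
  cong₂ ℕ._+_ (∣i-stepℤ[i]∣≡1 Sign.- a) (l1-unit-step x i Sign.+)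
l1-move (a ∷ x) {suc i} {suc j} i≢j =
  cong₂ ℕ._+_ (∣i-i∣≡0 a) (l1-move x (i≢j ∘ cong suc))

move⇒l1≡2 : ∀ {m} {x y : Vec ℤ m} {i j} → i ≢ j → y ≡ move i j x → l1 x y ≡ 2
move⇒l1≡2 {x = x} i≢j y≡ = trans (cong (l1 x) y≡) (l1-move x i≢j)

l1≡0⇒≡ : ∀ {m} (x y : Vec ℤ m) → l1 x y ≡ 0 → y ≡ x
l1≡0⇒≡ []      []      _ = refl
l1≡0⇒≡ (a ∷ x) (b ∷ y) d = cong₂ _∷_
  (sym (ℤₚ.i-j≡0⇒i≡j a b (ℤₚ.∣i∣≡0⇒i≡0 (ℕₚ.m+n≡0⇒m≡0 ∣ a - b ∣ d))))
  (l1≡0⇒≡ x y (ℕₚ.m+n≡0⇒n≡0 ∣ a - b ∣ d))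

l1≡1⇒unit-step : ∀ {m} (x y : Vec ℤ m) → l1 x y ≡ 1 →
                 Σ (Fin m) λ i → Σ Sign λ s → y ≡ updateAt x i (stepℤ s)
l1≡1⇒unit-step []      []      ()
l1≡1⇒unit-step (a ∷ x) (b ∷ y) d with a - b in eq
... | + 0 with ℤₚ.i-j≡0⇒i≡j a b eq
...   | refl with l1≡1⇒unit-step x y d
...     | i , s , y≡ = suc i , s , cong (a ∷_) y≡
l1≡1⇒unit-step (a ∷ x) (b ∷ y) d | + 1 =
  zero , Sign.- , cong₂ _∷_ (i-j≡c⇒j≡-c+i a b eq) (l1≡0⇒≡ x y (ℕₚ.suc-injective d))
l1≡1⇒unit-step (a ∷ x) (b ∷ y) d | -[1+ 0 ] =
  zero , Sign.+ , cong₂ _∷_ (i-j≡c⇒j≡-c+i a b eq) (l1≡0⇒≡ x y (ℕₚ.suc-injective d))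

-- Among vectors at ℓ¹-distance 2, the ones with the same coordinate sum are exactly the
-- unit transfers; the others (±2 in one coordinate, ±1 in two with equal signs) change it.
l1≡2⇒move : ∀ {m} (x y : Vec ℤ m) → l1 x y ≡ 2 → sumℤ y ≡ sumℤ x →
            Σ (Fin m) λ i → Σ (Fin m) λ j → i ≢ j × y ≡ move i j x
l1≡2⇒move []      []      () _
l1≡2⇒move (a ∷ x) (b ∷ y) d Σ≡ with a - b in eq
... | + 0 with ℤₚ.i-j≡0⇒i≡j a b eq
...   | refl with l1≡2⇒move x y d (∙-cancelˡ a (sumℤ y) (sumℤ x) Σ≡)
...     | i , j , i≢j , y≡ = suc i , suc j , i≢j ∘ Finₚ.suc-injective , cong (a ∷_) y≡
l1≡2⇒move (a ∷ x) (b ∷ y) d Σ≡ | + 1 with l1≡1⇒unit-step x y (ℕₚ.suc-injective d)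
... | i , Sign.+ , y≡ = suc i , zero , (λ ()) , cong₂ _∷_ (i-j≡c⇒j≡-c+i a b eq) y≡
... | i , Sign.- , y≡ = ⊥-elim (unit-steps-change-sumℤ Sign.- a x i
                          (subst₂ (λ b y → b +ℤ sumℤ y ≡ _) (i-j≡c⇒j≡-c+i a b eq) y≡ Σ≡))
l1≡2⇒move (a ∷ x) (b ∷ y) d Σ≡ | -[1+ 0 ] with l1≡1⇒unit-step x y (ℕₚ.suc-injective d)
... | i , Sign.- , y≡ = zero , suc i , (λ ()) , cong₂ _∷_ (i-j≡c⇒j≡-c+i a b eq) y≡
... | i , Sign.+ , y≡ = ⊥-elim (unit-steps-change-sumℤ Sign.+ a x i
                          (subst₂ (λ b y → b +ℤ sumℤ y ≡ _) (i-j≡c⇒j≡-c+i a b eq) y≡ Σ≡))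
l1≡2⇒move (a ∷ x) (b ∷ y) d Σ≡ | + 2
  with trans (sym eq) (j+k≡i+k⇒i-j≡0 a b (sumℤ x) (subst (λ y → b +ℤ sumℤ y ≡ _) y≡x Σ≡))
  where
  y≡x : y ≡ x
  y≡x = l1≡0⇒≡ x y (ℕₚ.suc-injective (ℕₚ.suc-injective d))
... | ()
l1≡2⇒move (a ∷ x) (b ∷ y) d Σ≡ | -[1+ 1 ]
  with trans (sym eq) (j+k≡i+k⇒i-j≡0 a b (sumℤ x) (subst (λ y → b +ℤ sumℤ y ≡ _) y≡x Σ≡))
  where
  y≡x : y ≡ x
  y≡x = l1≡0⇒≡ x y (ℕₚ.suc-injective (ℕₚ.suc-injective d))
... | ()

module _ {n : ℕ} where

  vertex-ext : {x y : A n} → proj₁ x ≡ proj₁ y → x ≡ y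
  vertex-ext {v , p} {.v , q} refl = cong (v ,_) (Decidable⇒UIP.≡-irrelevant ℤ._≟_ p q)

  Adj-irrelevant : {x y : A n} (a b : Adj x y) → a ≡ b
  Adj-irrelevant (adj p) (adj q) = cong adj (ℕₚ.≡-irrelevant p q)

  Adj-sym : {x y : A n} → Adj x y → Adj y x
  Adj-sym {x} {y} (adj p) = adj (trans (l1-sym (proj₁ y) (proj₁ x)) p)

  Adj⇒move : {x y : A n} → Adj x y →
             Σ (Fin (suc n)) λ i → Σ (Fin (suc n)) λ j → i ≢ j × proj₁ y ≡ move i j (proj₁ x)
  Adj⇒move {x} {y} (adj d) = l1≡2⇒move (proj₁ x) (proj₁ y) d (trans (proj₂ y) (sym (proj₂ x)))

  ∷-congˡ : {u y v : A n} (a : Adj u y) {γ γ' : Path y v} → γ ≃ γ' → (a ∷ γ) ≃ (a ∷ γ')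
  ∷-congˡ {y = y} a = concat (≃-refl {γ = a ∷ [ y ]})

  ·-congʳ : {u v w : A n} {γ γ' : Path u v} → γ ≃ γ' → (δ : Path v w) → (γ · δ) ≃ (γ' · δ)
  ·-congʳ γ≃γ' δ = concat γ≃γ' (≃-refl {γ = δ})

  square-by-cross-edge : {u y y' w : A n}
                         (a : Adj u y) (b : Adj y w) (a' : Adj u y') (b' : Adj y' w) →
                         Adj y y' → (a ∷ b ∷ [ w ]) ≃ (a' ∷ b' ∷ [ w ])
  square-by-cross-edge {w = w} a b a' b' c =
    ≃-trans (∷-congˡ a (≃-sym (triangle c b' b))) (·-congʳ (triangle a c a') (b' ∷ [ w ]))

  square-by-diagonal : {u y y' w : A n}
                       (a : Adj u y) (b : Adj y w) (a' : Adj u y') (b' : Adj y' w) →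
                       Adj u w → (a ∷ b ∷ [ w ]) ≃ (a' ∷ b' ∷ [ w ])
  square-by-diagonal a b a' b' d = ≃-trans (triangle a b d) (≃-sym (triangle a' b' d))

  -- shift k s adds s · (e_{k+1} - e_0).
  shift : Fin n → Sign → Vec ℤ (suc n) → Vec ℤ (suc n)
  shift k s (a ∷ x) = stepℤ (opposite s) a ∷ updateAt x k (stepℤ s)

  shift⁺≡move : ∀ x k → shift k Sign.+ x ≡ move (suc k) zero x
  shift⁺≡move (a ∷ x) k = refl

  shift⁻≡move : ∀ x k → shift k Sign.- x ≡ move zero (suc k) x
  shift⁻≡move (a ∷ x) k = refl

  shift-comm : ∀ x k s l t → shift l t (shift k s x) ≡ shift k s (shift l t x)
  shift-comm (a ∷ x) k s l t =
    cong₂ _∷_ (stepℤ-comm (opposite t) (opposite s) a) (updateAt-comm (stepℤ-comm t s) x k l)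

  shift-cancel : ∀ x k s → shift k (opposite s) (shift k s x) ≡ x
  shift-cancel (a ∷ x) k s = cong₂ _∷_ (stepℤ-opposite (opposite s) a) (begin
    updateAt (updateAt x k (stepℤ s)) k (stepℤ (opposite s))
      ≡⟨ updateAt-updateAt-local k {h = id} x (stepℤ-opposite s (lookup x k)) ⟩
    updateAt x k id
      ≡⟨ updateAt-id k x ⟩
    x ∎)
    where open ≡-Reasoning

  shift-diagonal : ∀ x i j → shift j Sign.- (shift i Sign.+ x) ≡ move (suc i) (suc j) x
  shift-diagonal (a ∷ x) i j = cong (_∷ _) (stepℤ-opposite Sign.- a)

  sumℤ-shift : ∀ x k s → sumℤ (shift k s x) ≡ sumℤ x
  sumℤ-shift x k Sign.+ = trans (cong sumℤ (shift⁺≡move x k)) (sumℤ-move x (suc k) zero)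
  sumℤ-shift x k Sign.- = trans (cong sumℤ (shift⁻≡move x k)) (sumℤ-move x zero (suc k))

  record Shifted (k : Fin n) (s : Sign) (x y : A n) : Set where
    constructor shifted
    field ≡shift : proj₁ y ≡ shift k s (proj₁ x)

  shiftᵛ : Fin n → Sign → A n → A n
  shiftᵛ k s x = shift k s (proj₁ x) , trans (sumℤ-shift (proj₁ x) k s) (proj₂ x)

  Shifted-shiftᵛ : ∀ {k s} (x : A n) → Shifted k s x (shiftᵛ k s x)
  Shifted-shiftᵛ x = shifted refl

  Shifted⇒Adj : {x y : A n} {k : Fin n} {s : Sign} → Shifted k s x y → Adj x y
  Shifted⇒Adj {x} {k = k} {Sign.+} (shifted y≡) =
    adj (move⇒l1≡2 (λ ()) (trans y≡ (shift⁺≡move (proj₁ x) k)))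
  Shifted⇒Adj {x} {k = k} {Sign.-} (shifted y≡) =
    adj (move⇒l1≡2 (λ ()) (trans y≡ (shift⁻≡move (proj₁ x) k)))

  shift-square-filler : ∀ (x : Vec ℤ (suc n)) {k l} s t → l ≢ k →
                        l1 (shift k s x) (shift l t x) ≡ 2 ⊎ l1 x (shift l t (shift k s x)) ≡ 2
  shift-square-filler x {k} {l} Sign.+ Sign.+ l≢k =
    inj₁ (move⇒l1≡2 (l≢k ∘ Finₚ.suc-injective) (begin
      shift l Sign.+ x                                   ≡⟨ shift-cancel (shift l Sign.+ x) k Sign.+ ⟨
      shift k Sign.- (shift k Sign.+ (shift l Sign.+ x)) ≡⟨ cong (shift k Sign.-) (shift-comm x l _ k _) ⟩
      shift k Sign.- (shift l Sign.+ (shift k Sign.+ x)) ≡⟨ shift-diagonal (shift k Sign.+ x) l k ⟩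
      move (suc l) (suc k) (shift k Sign.+ x)            ∎))
    where open ≡-Reasoning
  shift-square-filler x {k} {l} Sign.- Sign.- l≢k =
    inj₁ (move⇒l1≡2 (l≢k ∘ sym ∘ Finₚ.suc-injective) (begin
      shift l Sign.- x                                   ≡⟨ cong (shift l Sign.-) (shift-cancel x k Sign.-) ⟨
      shift l Sign.- (shift k Sign.+ (shift k Sign.- x)) ≡⟨ shift-diagonal (shift k Sign.- x) k l ⟩
      move (suc k) (suc l) (shift k Sign.- x)            ∎))
    where open ≡-Reasoning
  shift-square-filler x {k} {l} Sign.+ Sign.- l≢k =
    inj₂ (move⇒l1≡2 (l≢k ∘ sym ∘ Finₚ.suc-injective) (shift-diagonal x k l))
  shift-square-filler x {k} {l} Sign.- Sign.+ l≢k =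
    inj₂ (move⇒l1≡2 (l≢k ∘ Finₚ.suc-injective)
                    (trans (shift-comm x k Sign.- l Sign.+) (shift-diagonal x l k)))

  coord : A n → Fin n → ℤ
  coord x k = lookup (proj₁ x) (suc k)

  coord-shift : ∀ {x y : A n} {k s} → Shifted k s x y → coord y k ≡ stepℤ s (coord x k)
  coord-shift {x} {k = k} {s} (shifted y≡) =
    trans (cong (λ v → lookup v (suc k)) y≡) (lookup-shift (proj₁ x))
    where
    lookup-shift : ∀ v → lookup (shift k s v) (suc k) ≡ stepℤ s (lookup v (suc k))
    lookup-shift (a ∷ v) = lookup∘updateAt k v

  coord-shift-other : ∀ {x y : A n} {k l s} → l ≢ k → Shifted l s x y → coord y k ≡ coord x k
  coord-shift-other {x} {k = k} {l} {s} l≢k (shifted y≡) =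
    trans (cong (λ v → lookup v (suc k)) y≡) (lookup-shift-other (proj₁ x))
    where
    lookup-shift-other : ∀ v → lookup (shift l s v) (suc k) ≡ lookup v (suc k)
    lookup-shift-other (a ∷ v) = lookup∘updateAt′ k l (l≢k ∘ sym) v

  shift-square : {u y y' w : A n} {k l : Fin n} {s t : Sign} → l ≢ k →
                 Shifted k s u y → Shifted l t u y' → Shifted l t y w →
                 (a : Adj u y) (b : Adj y w) (a' : Adj u y') (b' : Adj y' w) →
                 (a ∷ b ∷ [ w ]) ≃ (a' ∷ b' ∷ [ w ])
  shift-square {u} {s = s} {t} l≢k (shifted y≡) (shifted y'≡) (shifted w≡) a b a' b'
    with shift-square-filler (proj₁ u) s t l≢k
  ... | inj₁ cross = square-by-cross-edge a b a' b'
                       (adj (subst₂ (λ p q → l1 p q ≡ 2) (sym y≡) (sym y'≡) cross))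
  ... | inj₂ diagonal = square-by-diagonal a b a' b'
                          (adj (subst (λ q → l1 (proj₁ u) q ≡ 2) (sym (trans w≡ (cong (shift _ t) y≡)))
                                      diagonal))

  edge-irrelevant : {x y v : A n} (a b : Adj x y) (γ : Path y v) → (a ∷ γ) ≃ (b ∷ γ)
  edge-irrelevant a b γ rewrite Adj-irrelevant a b = ≃-refl

  data ShiftPath : A n → A n → Set where
    done : (u : A n) → ShiftPath u u
    step : {u w v : A n} {k : Fin n} {s : Sign} →
           Shifted k s u w → ShiftPath w v → ShiftPath u v

  toPath : {u v : A n} → ShiftPath u v → Path u v
  toPath (done u)   = [ u ]
  toPath (step e g) = Shifted⇒Adj e ∷ toPath g

  length : {u v : A n} → ShiftPath u v → ℕ
  length (done u)   = 0
  length (step _ g) = suc (length g)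

  Pushed : {u y v : A n} {k : Fin n} {s : Sign} → Shifted k s u y → ShiftPath y v → Set
  Pushed {u} {y} {v} {k} {s} e g =
    (Σ (ShiftPath u v) λ g' → length g' ≤ length g × (Shifted⇒Adj e ∷ toPath g) ≃ toPath g')
    ⊎ coord y k ≤[ s ] coord v k

  push : {u y v : A n} {k : Fin n} {s : Sign} (e : Shifted k s u y) (g : ShiftPath y v) →
         Pushed e g

  push-along : {u y w v : A n} {k : Fin n} {s : Sign}
               (e : Shifted k s u y) (e' : Shifted k s y w) (g : ShiftPath w v) →
               Pushed e (step e' g)
  push-along {y = y} {w} {k = k} {s} e e' g with push e' g
  ... | inj₁ (g' , g'≤g , h) = inj₁ (step e g' , s≤s g'≤g , ∷-congˡ _ h)
  ... | inj₂ w≤v = inj₂ (≤[]-trans s y≤w w≤v)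
    where
    y≤w : coord y k ≤[ s ] coord w k
    y≤w = subst (coord y k ≤[ s ]_) (sym (coord-shift e')) (i≤[s]stepℤ[i] s (coord y k))

  push-back : {u y w v : A n} {k : Fin n} {s : Sign}
              (e : Shifted k s u y) (e' : Shifted k (opposite s) y w) (g : ShiftPath w v) →
              Pushed e (step e' g)
  push-back {u} {w = w} {k = k} {s} e@(shifted y≡) e'@(shifted w≡) g
    with vertex-ext {w} {u}
           (trans w≡ (trans (cong (shift k (opposite s)) y≡) (shift-cancel (proj₁ u) k s)))
  ... | refl = inj₁ (g , ℕₚ.n≤1+n (length g) ,
                     ·-congʳ (backtrack (Shifted⇒Adj e) (Shifted⇒Adj e')) (toPath g))

  push-past : {u y w v : A n} {k l : Fin n} {s t : Sign} → l ≢ k →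
              (e : Shifted k s u y) (e' : Shifted l t y w) (g : ShiftPath w v) →
              Pushed e (step e' g)
  push-past {u} {w = w} {k = k} {l} {s} {t} l≢k e@(shifted y≡) e'@(shifted w≡) g
    with push (shifted {x = shiftᵛ l t u} w≡′) g
    where
    w≡′ : proj₁ w ≡ shift k s (shift l t (proj₁ u))
    w≡′ = trans w≡ (trans (cong (shift l t) y≡) (shift-comm (proj₁ u) k s l t))
  ... | inj₁ (g' , g'≤g , h) =
    inj₁ (step (Shifted-shiftᵛ u) g' , s≤s g'≤g ,
          ≃-trans (·-congʳ (shift-square l≢k e (Shifted-shiftᵛ u) e' _ _ _ _) (toPath g))
                  (∷-congˡ _ h))
  ... | inj₂ w≤v = inj₂ (subst (_≤[ s ] _) (coord-shift-other l≢k e') w≤v)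

  push e (done _) = inj₂ (≤[]-refl _ _)
  push {k = k} e (step {k = l} e' g) with l Finₚ.≟ k
  push {s = Sign.+} e (step {s = Sign.+} e' g) | yes refl = push-along e e' g
  push {s = Sign.-} e (step {s = Sign.-} e' g) | yes refl = push-along e e' g
  push {s = Sign.+} e (step {s = Sign.-} e' g) | yes refl = push-back e e' g
  push {s = Sign.-} e (step {s = Sign.+} e' g) | yes refl = push-back e e' g
  ... | no l≢k = push-past l≢k e e' g

  shift-loop-null : ∀ m {u : A n} (g : ShiftPath u u) → length g ≤ m → toPath g ≃ [ u ]
  shift-loop-null _       (done u)                         _         = ≃-refl
  shift-loop-null (suc m) {u} (step {k = k} {s} e g) (s≤s g≤m) with push e g
  ... | inj₁ (g' , g'≤g , h) = ≃-trans h (shift-loop-null m g' (ℕₚ.≤-trans g'≤g g≤m))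
  ... | inj₂ y≤u =
    ⊥-elim (stepℤ[i]≰[s]i s (coord u k) (subst (_≤[ s ] coord u k) (coord-shift e) y≤u))

  cons-shifts : {x y v : A n} (a : Adj x y) (g : ShiftPath y v) →
                Σ (ShiftPath x v) λ g' → (a ∷ toPath g) ≃ toPath g'
  cons-shifts {x} {y} a g with Adj⇒move a
  ... | zero  , zero  , i≢j , _  = ⊥-elim (i≢j refl)
  ... | zero  , suc j , _   , y≡ =
    step (shifted (trans y≡ (sym (shift⁻≡move (proj₁ x) j)))) g , edge-irrelevant _ _ (toPath g)
  ... | suc i , zero  , _   , y≡ =
    step (shifted (trans y≡ (sym (shift⁺≡move (proj₁ x) i)))) g , edge-irrelevant _ _ (toPath g)
  ... | suc i , suc j , _   , y≡ =
    step e (step e' g) ,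
    ·-congʳ (≃-sym (triangle (Shifted⇒Adj e) (Shifted⇒Adj e') a)) (toPath g)
    where
    e : Shifted i Sign.+ x (shiftᵛ i Sign.+ x)
    e = Shifted-shiftᵛ x
    e' : Shifted j Sign.- (shiftᵛ i Sign.+ x) y
    e' = shifted (trans y≡ (sym (shift-diagonal (proj₁ x) i j)))

  straighten : {u v : A n} (γ : Path u v) → Σ (ShiftPath u v) λ g → γ ≃ toPath g
  straighten [ u ] = done u , ≃-refl
  straighten (a ∷ γ) with straighten γ
  ... | g , γ≃g with cons-shifts a g
  ...   | g' , aγ≃g' = g' , ≃-trans (∷-congˡ a γ≃g) aγ≃g'

  loop-null : {u : A n} (γ : Path u u) → γ ≃ [ u ]
  loop-null γ with straighten γ
  ... | g , γ≃g = ≃-trans γ≃g (shift-loop-null (length g) g ℕₚ.≤-refl)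

  paths-homotopic : {u v : A n} (γ γ' : Path u v) → γ ≃ γ'
  paths-homotopic [ u ] γ' = ≃-sym (loop-null γ')
  paths-homotopic (a ∷ γ) γ' =
    ≃-trans (∷-congˡ a (paths-homotopic γ (Adj-sym a ∷ γ'))) (·-congʳ (backtrack a (Adj-sym a)) γ')

corollary4p9 : (n : ℕ) (u v : A n) (γ γ' : Path u v) → γ ≃ γ'
corollary4p9 n u v = paths-homotopic
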